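{- Let $k\ge3$. For $n\ge k+1$, the gap $G_n$ occurring between the two successive kernel words $R_n$ and $R_{n+1}$ is given by $$G_n=\begin{cases}G_{n-k}\Big(\prod_{i=k-1}^{2}(R_{n-i}G_{n-i})\Big)R_{n-1}[1,r_{n-2}+1]\;s_k^{n-2}(2)\,\ast & \text{if } n-1\equiv 1\pmod k,\\ G_{n-k}\Big(\prod_{i=k-1}^{2}(R_{n-i}G_{n-i})\Big)R_{n-1}[1,r_{n-2}]\;s_k^{n-2}(2)\,\ast & \text{otherwise,}\end{cases}$$ where $\ast$ is a suffix of $s_k^{n-2}(0)$ and is defined by $$\ast=\begin{cases}R_{n+1}[1,r_n+1]^{ -1} & \text{if } n\equiv0\pmod k,\\ R_{n+1}[1,r_n]^{ -1} & \text{otherwise.}\end{cases}$$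
   Context: Let $\mathcal{A}_k=\{0,1,\dots,k-1\}$ and let $s_k$ be the morphism of $\mathcal{A}_k^*$ with $s_k(m)=0(m+1)$ (a two-letter word) for $0\le m\le k-2$ and $s_k(k-1)=00$. The generalized period-doubling sequence is $\mathbf{P}_k=\lim_n s_k^n(0)$. Mirror substitution: $\tilde s_k$ is the morphism with $\tilde s_k(m)=\mathbf{E}_k(m)0$, where $\mathbf{E}_k(m)=m+1$ for $0\le m\le k-2$ and $\mathbf{E}_k(k-1)=0$. Words: $\varepsilon$ is the empty word; $u[i,j]$ is the factor of $u$ from its $i$-th to its $j$-th letter (letters indexed from 1). $v^{ -1}$ is the inverse of the word $v$, with $vv^{ -1}=v^{ -1}v=\varepsilon$; thus $uv^{ -1}$ is $u$ with its suffix $v$ deleted and $0^{ -1}u$ is $u$ with its first letter $0$ deleted. The product $\prod_{i=k-1}^{2}$ is a concatenation in decreasing order of $i$, from $i=k-1$ down to $i=2$. Kernel numbers: $r_0=0$, $r_1=\dots=r_k=1$, and $r_i=r_{i-1}+r_{i-2}+\cdots+r_{i-(k-1)}+2r_{i-k}-(k-2)$ for $i>k$. Kernel words: $R_0=\varepsilon$, $R_i$ is the one-letter word $(i-1)$ for $1\le i\le k$, $R_{k+1}=000$, $R_{k+2}=10101$, and for $i>k+2$, $R_i=0^{ -1}s_k(R_{i-1})$ if $i$ is even and $R_i=s_k(R_{i-1})0$ otherwise. Palindromic prefixes: $p_0=\varepsilon$, $p_{n+1}=p_n\vartheta_np_n$ with $\vartheta_n=n \bmod k$ viewed as a letter. Gap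 words ($G_n$ denotes the gap between the kernel words $R_n$ and $R_{n+1}$ in $\mathbf{P}_k$): $G_n=p_{n-1}$ for $1\le n\le k-1$; $G_k=s_k(G_{k-1})$; $G_{k+1}=\tilde s_k(G_k)$; and $G_n=s_k(G_{n-1})0$ for all $n\ge k+2$.
   Formalization: Corrected: for i>k+2, R_i=s_k(R_{i-1})0 iff i≡1 (mod k), not i odd; for n≥k+2, G_n is s_k(G_{n-1}) if n≡0, s̃_k(G_{n-1}) if n≡1 (mod k), else s_k(G_{n-1})0; and the word inverted in ∗ is a suffix of s_k^{n-2}(2), not s_k^{n-2}(0). The literal forms fail (e.g. k=3, n=6). -}

module Defs where

open import Data.Bool.Base using (if_then_else_)
open import Data.Fin.Base using (Fin; toℕ; fromℕ<)
open import Data.List.Base using (List; []; _∷_; _++_; concatMap; drop; downFrom; head; length; map; take)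
open import Data.Maybe.Base using (fromMaybe)
open import Data.Nat.Base using (ℕ; zero; suc; _+_; _*_; _∸_; _≤ᵇ_; _<ᵇ_; _≡ᵇ_; NonZero)
open import Data.Nat.DivMod using (_%_; _mod_)
open import Data.Nat.GeneralisedArithmetic using (fold)
open import Data.Nat.ListAction using (sum)
open import Data.Nat.Properties using (_<?_)
open import Relation.Nullary.Decidable.Core using (yes; no)

-- Letters are indexed from 1; indices are meant to satisfy 1 ≤ i and j ≤ length u.
infix 8 _⟦_⋯_⟧
_⟦_⋯_⟧ : {A : Set} → List A → ℕ → ℕ → List A
u ⟦ i ⋯ j ⟧ = take (suc j ∸ i) (drop (i ∸ 1) u)

-- Meaningful only when v is a suffix of u.
infix 7 _·_⁻¹
_·_⁻¹ : {A : Set} → List A → List A → List A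
u · v ⁻¹ = take (length u ∸ length v) u

-- f hi ++ f (hi ∸ 1) ++ ⋯ ++ f lo
∏[_↘_] : {A : Set} → ℕ → ℕ → (ℕ → List A) → List A
∏[ hi ↘ lo ] f = concatMap f (map (lo +_) (downFrom (suc hi ∸ lo)))

module _ (k : ℕ) .{{_ : NonZero k}} where

  Letter : Set
  Letter = Fin k

  Word : Set
  Word = List Letter

  -- i itself when i < k; the reduction mod k matters only in p.
  letter : ℕ → Letter
  letter i = i mod k

  E : Letter → Letter
  E m with suc (toℕ m) <? k
  ... | yes m+1<k = fromℕ< m+1<k
  ... | no  _     = letter 0

  s : Word → Word
  s = concatMap λ m → letter 0 ∷ E m ∷ []

  s̃ : Word → Word
  s̃ = concatMap λ m → E m ∷ letter 0 ∷ []

  s^ : ℕ → Word → Word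
  s^ n u = fold u s n

  -- From h = r (i ∸ 1) ∷ r (i ∸ 2) ∷ ⋯ ∷ r 0 ∷ [] to r i; in the last branch the
  -- (k ∸ 1)-st tail of h starts with r (i ∸ k). All kernel numbers of positive
  -- index are at least 1, so the subtraction there is never truncated.
  nextKernelNumber : ℕ → List ℕ → ℕ
  nextKernelNumber i h =
    if i ≤ᵇ k then 1
    else sum (take (k ∸ 1) h) + 2 * fromMaybe 0 (head (drop (k ∸ 1) h)) ∸ (k ∸ 2)

  -- r n ∷ r (n ∸ 1) ∷ ⋯ ∷ r 0 ∷ []
  kernelNumbers : ℕ → List ℕ
  kernelNumbers zero    = 0 ∷ []
  kernelNumbers (suc n) = nextKernelNumber (suc n) (kernelNumbers n) ∷ kernelNumbers n

  r : ℕ → ℕ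
  r n = fromMaybe 0 (head (kernelNumbers n))

  -- The condition i ≡ 1 (mod k) for the form s(R (i ∸ 1))0 reads "i odd" when
  -- k = 2. For k ≥ 3 the parity of i would be wrong: the lengths of the words
  -- would not be the kernel numbers (for k = 4, length 11 against r 7 = 9).
  -- In the form 0⁻¹ s(R (i ∸ 1)), the letter dropped is always a 0.
  R : ℕ → Word
  R zero    = []
  R (suc i) =
    if      suc i ≤ᵇ k       then letter i ∷ []
    else if suc i ≡ᵇ k + 1   then letter 0 ∷ letter 0 ∷ letter 0 ∷ []
    else if suc i ≡ᵇ k + 2   then letter 1 ∷ letter 0 ∷ letter 1 ∷ letter 0 ∷ letter 1 ∷ []
    else if suc i % k ≡ᵇ 1   then s (R i) ++ letter 0 ∷ []
    else                          drop 1 (s (R i))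

  p : ℕ → Word
  p zero    = []
  p (suc n) = p n ++ letter n ∷ p n

  -- The gaps in the factorization R₁ G₁ R₂ G₂ ⋯ of the fixed point of s; G 0 is
  -- a dummy value. Apply s to R (n ∸ 1) ++ G (n ∸ 1) ++ R n. In general s(R n)
  -- gives up its first 0 to the gap, whence s(G (n ∸ 1))0. If n ≡ 0 (mod k) it
  -- does not, whence s(G (n ∸ 1)). If n ≡ 1 it does, but R n takes the first 0
  -- of s(G (n ∸ 1)), whence s̃(G (n ∸ 1)) = 0⁻¹ s(G (n ∸ 1)) 0. So the forms taken
  -- at n = k and n = k + 1 must recur with period k: with s(G (n ∸ 1))0 at every
  -- n ≥ k + 2, already G 6 for k = 3 would be one letter too long.
  G : ℕ → Word
  G zero    = []
  G (suc n) =
    if      suc n <ᵇ k       then p n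
    else if suc n % k ≡ᵇ 0   then s (G n)
    else if suc n % k ≡ᵇ 1   then s̃ (G n)
    else                          s (G n) ++ letter 0 ∷ []

{-# OPTIONS --safe #-}
-- The idea: all the words involved are carried from index n to n + 1 by s, up to
-- single letters 0 at the ends. Let g n be 0 if n ≡ 0 (mod k) and ε otherwise,
-- and h n the other one of the two, and let V n be the prefix of R (n + 1) that
-- the statement singles out. Then
--   s(R n) g n = h n R (n + 1),   s(G n) h (n + 1) = g n G (n + 1),
--   s(V n) = h (n + 1) V (n + 1).
-- Applying s to
--   G (m + k) V (m + k) = G m · ∏ R i G i · V (m + k - 2) · s^(m + k - 2)(2)
-- therefore gives the same equation for m + 1, as the letters h telescope and
-- g m = g (m + k) can be cancelled. For m = 0 the equation comes from its
-- analogue for 2 ≤ n ≤ k, in which the product starts at i = 1.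
module Submission where

open import Defs
open import Data.Bool.Base using (Bool; true; false; if_then_else_; not)
open import Data.Bool.Properties using (if-float)
open import Data.Fin.Base using (toℕ)
open import Data.Fin.Properties using (toℕ-fromℕ<; toℕ-injective)
open import Data.List.Base using (List; []; _∷_; _++_; concatMap; drop; downFrom; length; map; take)
open import Data.List.Properties
  using (++-assoc; ++-identityʳ; ++-cancelˡ; ++-cancelʳ; concatMap-++; length-++)
import Data.List.Relation.Binary.Pointwise as Pointwise
open import Data.List.Relation.Binary.Suffix.Heterogeneous using (Suffix; here; _++ˢ_)
open import Data.Nat.Base using (ℕ; zero; suc; _+_; _*_; _∸_; _≤_; _<_; _≡ᵇ_; z≤n; s≤s; NonZero)
open import Data.Nat.DivMod using (_%_; %-distribˡ-+; m%n<n; m<n⇒m%n≡m; n%n≡0; [m+n]%n≡m%n)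
open import Data.Nat.ListAction using (sum)
open import Data.Nat.Properties
open import Data.Nat.Tactic.RingSolver using (solve-∀)
open import Data.Product.Base using (_×_; _,_; proj₁; proj₂; ∃-syntax)
open import Data.Sum.Base using (inj₁; inj₂)
open import Relation.Binary.PropositionalEquality
open import Relation.Binary.Definitions using (tri<; tri≈; tri>)
open import Relation.Nullary.Decidable using (yes; no; dec-true; dec-false)
open import Relation.Nullary.Negation using (contradiction)
open ≡-Reasoning

-- Prefixes of lists and removal of suffixes

take-++-≤ : ∀ {A : Set} n (xs ys : List A) → n ≤ length xs → take n (xs ++ ys) ≡ take n xs
take-++-≤ zero    xs       ys _         = refl
take-++-≤ (suc n) (x ∷ xs) ys (s≤s n≤l) = cong (x ∷_) (take-++-≤ n xs ys n≤l)

take-length-+ : ∀ {A : Set} (xs : List A) n ys → take (length xs + n) (xs ++ ys) ≡ xs ++ take n ys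
take-length-+ []       n ys = refl
take-length-+ (x ∷ xs) n ys = cong (x ∷_) (take-length-+ xs n ys)

++-·⁻¹ : ∀ {A : Set} (u v : List A) → (u ++ v) · v ⁻¹ ≡ u
++-·⁻¹ u v = begin
  take (length (u ++ v) ∸ length v) (u ++ v)  ≡⟨ cong (λ l → take l (u ++ v)) length-diff ⟩
  take (length u + 0) (u ++ v)                ≡⟨ take-length-+ u 0 v ⟩
  u ++ []                                     ≡⟨ ++-identityʳ u ⟩
  u                                           ∎
  where
  length-diff : length (u ++ v) ∸ length v ≡ length u + 0
  length-diff = begin
    length (u ++ v) ∸ length v      ≡⟨ cong (_∸ length v) (length-++ u) ⟩
    length u + length v ∸ length v  ≡⟨ m+n∸n≡m (length u) (length v) ⟩
    length u                        ≡⟨ +-identityʳ (length u) ⟨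
    length u + 0                    ∎

-- Optional letters 0 and the morphism `s`

bit : Bool → ℕ
bit b = if b then 1 else 0

bit≤1 : ∀ b → bit b ≤ 1
bit≤1 true  = ≤-refl
bit≤1 false = z≤n

bit-not : ∀ b → bit (not b) + bit b ≡ 1
bit-not true  = refl
bit-not false = refl

module _ (k : ℕ) .{{_ : NonZero k}} where

  mark : Bool → Word k
  mark b = if b then letter k 0 ∷ [] else []

  length-mark : ∀ b → length (mark b) ≡ bit b
  length-mark true  = refl
  length-mark false = refl

  toℕ-letter : ∀ i → toℕ (letter k i) ≡ i % k
  toℕ-letter i = toℕ-fromℕ< (m%n<n i k)

  letter-cong : ∀ {i j} → i % k ≡ j % k → letter k i ≡ letter k j
  letter-cong {i} {j} eq =
    toℕ-injective (trans (toℕ-letter i) (trans eq (sym (toℕ-letter j))))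

  s-++ : ∀ u v → s k (u ++ v) ≡ s k u ++ s k v
  s-++ = concatMap-++ _

  length-s : ∀ u → length (s k u) ≡ 2 * length u
  length-s []      = refl
  length-s (x ∷ u) = begin
    2 + length (s k u)  ≡⟨ cong (2 +_) (length-s u) ⟩
    2 + 2 * length u    ≡⟨ *-suc 2 (length u) ⟨
    2 * suc (length u)  ∎

  s-take : ∀ n u → s k (take n u) ≡ take (n * 2) (s k u)
  s-take zero    u       = refl
  s-take (suc n) []      = refl
  s-take (suc n) (x ∷ u) = cong (λ w → letter k 0 ∷ E k x ∷ w) (s-take n u)

  s-nonempty : ∀ u → 1 ≤ length u → s k u ≡ letter k 0 ∷ drop 1 (s k u)
  s-nonempty (x ∷ u) _ = refl

  -- Both sides alternate 0 with the letters `E x`, beginning and ending with 0; they differ only in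
  -- how the letters are paired.
  0-s̃ : ∀ u → letter k 0 ∷ s̃ k u ≡ s k u ++ letter k 0 ∷ []
  0-s̃ []      = refl
  0-s̃ (x ∷ u) = cong (λ w → letter k 0 ∷ E k x ∷ w) (0-s̃ u)

  -- Marks, blocks and prefixes

  z : ℕ → Bool
  z n = n % k ≡ᵇ 0

  z-period : ∀ n → z (n + k) ≡ z n
  z-period n = cong (_≡ᵇ 0) ([m+n]%n≡m%n n k)

  g : ℕ → Word k
  g n = mark (z n)

  h : ℕ → Word k
  h n = mark (not (z n))

  F : ℕ → Word k
  F n = R k n ++ G k n

  V : ℕ → Word k
  V n = take (r k n + bit (z n)) (R k (suc n))

  V-≡ : ∀ n → (if z n then R k (suc n) ⟦ 1 ⋯ r k n + 1 ⟧ else R k (suc n) ⟦ 1 ⋯ r k n ⟧) ≡ V n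
  V-≡ n with z n
  ... | true  = refl
  ... | false = cong (λ l → take l (R k (suc n))) (sym (+-identityʳ (r k n)))

  -- F a ++ F (a + 1) ++ ⋯ with c factors
  blocks : ℕ → ℕ → Word k
  blocks a zero    = []
  blocks a (suc c) = F a ++ blocks (suc a) c

  -- While `i` falls from `c + 1` to 2, the index `n ∸ i` rises from `a`.
  ∏-descending : ∀ c a n → n ≡ suc a + c →
    concatMap (λ i → F (n ∸ i)) (map (2 +_) (downFrom c)) ≡ blocks a c
  ∏-descending zero    a n eq = refl
  ∏-descending (suc c) a n eq = cong₂ _++_
    (cong F (begin
      n ∸ (2 + c)              ≡⟨ cong (_∸ (2 + c)) eq ⟩
      suc a + suc c ∸ (2 + c)  ≡⟨ cong (_∸ suc c) (+-suc a c) ⟩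
      suc (a + c) ∸ suc c      ≡⟨ m+n∸n≡m a c ⟩
      a                        ∎))
    (∏-descending c (suc a) n (trans eq (cong suc (+-suc a c))))

  -- Residues modulo `k` and letters

  module _ (1<k : 1 < k) where

    0<k : 0 < k
    0<k = <⇒≤ 1<k

    0%k : 0 % k ≡ 0
    0%k = m<n⇒m%n≡m 0<k

    suc-% : ∀ i → suc i % k ≡ suc (i % k) % k
    suc-% i = begin
      suc i % k            ≡⟨ %-distribˡ-+ 1 i k ⟩
      (1 % k + i % k) % k  ≡⟨ cong (λ x → (x + i % k) % k) (m<n⇒m%n≡m 1<k) ⟩
      suc (i % k) % k      ∎

    -- Every test for residue 1, in `R`, in `G` and in the statement, thereby becomes a test of `z`
    -- at the preceding index.
    suc-%≡1 : ∀ i → (suc i % k ≡ᵇ 1) ≡ z i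
    suc-%≡1 i rewrite suc-% i with i % k | m≤n⇒m<n∨m≡n (m%n<n i k)
    ... | x | inj₁ 1+x<k rewrite m<n⇒m%n≡m 1+x<k = refl
    -- Residue 0 would at the same time be the last residue `k - 1`.
    ... | zero  | inj₂ 1≡k   = contradiction 1<k (<-irrefl 1≡k)
    ... | suc x | inj₂ 2+x≡k =
      cong (_≡ᵇ 1) (trans (cong (_% k) 2+x≡k) (n%n≡0 k))

    -- `E` is the successor modulo `k`: if it wraps around, the residue of `i` is `k - 1` and both
    -- sides are the letter 0.
    E-letter : ∀ i → E k (letter k i) ≡ letter k (suc i)
    E-letter i with suc (toℕ (letter k i)) <? k
    ... | yes lt = toℕ-injective (begin
      toℕ _                       ≡⟨ toℕ-fromℕ< lt ⟩
      suc (toℕ (letter k i))      ≡⟨ m<n⇒m%n≡m lt ⟨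
      suc (toℕ (letter k i)) % k  ≡⟨ cong (λ x → suc x % k) (toℕ-letter i) ⟩
      suc (i % k) % k             ≡⟨ suc-% i ⟨
      suc i % k                   ≡⟨ toℕ-letter (suc i) ⟨
      toℕ (letter k (suc i))      ∎)
    ... | no nlt = letter-cong (begin
      0 % k            ≡⟨ 0%k ⟩
      0                ≡⟨ n%n≡0 k ⟨
      k % k
        ≡⟨ cong (_% k) (≤-antisym (subst (λ x → k ≤ suc x) (toℕ-letter i) (≮⇒≥ nlt)) (m%n<n i k)) ⟩
      suc (i % k) % k  ≡⟨ suc-% i ⟨
      suc i % k        ∎)

    z-0 : z 0 ≡ true
    z-0 = cong (_≡ᵇ 0) 0%k

    z-k : z k ≡ true
    z-k = cong (_≡ᵇ 0) (n%n≡0 k)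

    z-small : ∀ i → suc i < k → z (suc i) ≡ false
    z-small i lt = cong (_≡ᵇ 0) (m<n⇒m%n≡m lt)

    z-suc : ∀ i → z i ≡ true → z (suc i) ≡ false
    z-suc i eq with suc i % k | suc-%≡1 i
    ... | zero  | e = contradiction (trans e eq) (λ ())
    ... | suc _ | e = refl

    -- One rule for all kernel words

    R-small : ∀ i → i < k → R k (suc i) ≡ letter k i ∷ []
    R-small i i<k rewrite dec-true (suc i ≤? k) i<k = refl

    R-1+k : R k (suc k) ≡ letter k 0 ∷ letter k 0 ∷ letter k 0 ∷ []
    R-1+k rewrite dec-false (suc k ≤? k) (<-irrefl refl)
                | dec-true (suc k ≟ k + 1) (+-comm 1 k) = refl

    s-R-small : ∀ i → i < k → s k (R k (suc i)) ≡ letter k 0 ∷ letter k (suc i) ∷ []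
    s-R-small i i<k = begin
      s k (R k (suc i))                   ≡⟨ cong (s k) (R-small i i<k) ⟩
      letter k 0 ∷ E k (letter k i) ∷ []  ≡⟨ cong (λ x → letter k 0 ∷ x ∷ []) (E-letter i) ⟩
      letter k 0 ∷ letter k (suc i) ∷ []  ∎

    letter-k : letter k k ≡ letter k 0
    letter-k = letter-cong (trans (n%n≡0 k) (sym 0%k))

    -- The rule for large indices, which in fact holds at every index.
    nextKernelWord : ℕ → Word k
    nextKernelWord i = if z i then s k (R k i) ++ letter k 0 ∷ [] else drop 1 (s k (R k i))

    R-suc-small : ∀ i → i < k → R k (suc i) ≡ nextKernelWord i
    R-suc-small zero    _   rewrite R-small 0 0<k | z-0 = refl
    R-suc-small (suc i) i<k rewrite R-small (suc i) i<k | z-small i i<k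
                                  | s-R-small i (<⇒≤ i<k) = refl

    -- The rule yields s(k - 1)0 = 000, as `letter k k` is the letter 0.
    R-suc-k : ∀ i → i ≡ k → R k (suc i) ≡ nextKernelWord i
    R-suc-k zero    refl = contradiction 0<k (<-irrefl refl)
    R-suc-k (suc i) refl = begin
      R k (suc k)       ≡⟨ R-1+k ⟩
      letter k 0 ∷ letter k 0 ∷ letter k 0 ∷ []
        ≡⟨ cong (λ x → letter k 0 ∷ x ∷ letter k 0 ∷ []) letter-k ⟨
      letter k 0 ∷ letter k k ∷ letter k 0 ∷ []
        ≡⟨ cong (_++ letter k 0 ∷ []) (s-R-small i ≤-refl) ⟨
      s k (R k k) ++ letter k 0 ∷ []
        ≡⟨ cong (λ b → if b then s k (R k k) ++ letter k 0 ∷ [] else drop 1 (s k (R k k)))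
             z-k ⟨
      nextKernelWord k  ∎

    -- Since `z (suc k)` fails, the rule removes the first letter of s(000) = 010101, which leaves
    -- 10101.
    R-suc-1+k : R k (suc (suc k)) ≡ nextKernelWord (suc k)
    R-suc-1+k rewrite R-1+k | z-suc k z-k | E-letter 0
      | dec-false (suc (suc k) ≤? k) (λ 2+k≤k → <-irrefl refl (<⇒≤ 2+k≤k))
      | dec-false (suc (suc k) ≟ k + 1) (λ eq → <-irrefl (sym (trans eq (+-comm k 1))) ≤-refl)
      | dec-true (suc (suc k) ≟ k + 2) (+-comm 2 k) = refl

    R-suc-large : ∀ i → suc k < i → R k (suc i) ≡ nextKernelWord i
    R-suc-large i 1+k<i
      rewrite dec-false (suc i ≤? k) (λ i<k → <-asym (<⇒≤ 1+k<i) i<k)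
      | dec-false (suc i ≟ k + 1) (λ eq → <-irrefl (sym (trans eq (+-comm k 1))) (s≤s (<⇒≤ 1+k<i)))
      | dec-false (suc i ≟ k + 2) (λ eq → <-irrefl (sym (trans eq (+-comm k 2))) (s≤s 1+k<i))
      | suc-%≡1 i = refl

    R-suc : ∀ i → R k (suc i) ≡ nextKernelWord i
    R-suc i with <-cmp i k
    ... | tri< i<k _ _ = R-suc-small i i<k
    ... | tri≈ _ i≡k _ = R-suc-k i i≡k
    ... | tri> _ _ k<i with m≤n⇒m<n∨m≡n k<i
    ...   | inj₁ 1+k<i = R-suc-large i 1+k<i
    ...   | inj₂ refl  = R-suc-1+k

    -- One rule for all gap words

    -- In the image of `p n`, `letter n`, `p n`, the 0 that starts the image of the middle letter
    -- completes the first copy to `p (n + 1)`, and the appended 0 completes the second.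
    s-p : ∀ n → s k (p k n) ++ letter k 0 ∷ [] ≡ p k (suc n)
    s-p zero    = refl
    s-p (suc n) = begin
      s k (p k n ++ letter k n ∷ p k n) ++ 0̲                    ≡⟨ cong (_++ 0̲) (s-++ (p k n) _) ⟩
      (s k (p k n) ++ letter k 0 ∷ E k (letter k n) ∷ s k (p k n)) ++ 0̲
        ≡⟨ ++-assoc (s k (p k n)) _ _ ⟩
      s k (p k n) ++ 0̲ ++ E k (letter k n) ∷ s k (p k n) ++ 0̲  ≡⟨ ++-assoc (s k (p k n)) 0̲ _ ⟨
      (s k (p k n) ++ 0̲) ++ E k (letter k n) ∷ s k (p k n) ++ 0̲
        ≡⟨ cong₂ (λ u x → u ++ x ∷ u) (s-p n) (E-letter n) ⟩
      p k (suc n) ++ letter k (suc n) ∷ p k (suc n)              ∎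
      where 0̲ = letter k 0 ∷ []

    G-small : ∀ n → suc n < k → G k (suc n) ≡ p k n
    G-small n lt rewrite dec-true (suc n <? k) lt = refl

    nextGap : ℕ → Word k
    nextGap n =
      if      z (suc n) then s k (G k n)
      else if z n       then s̃ k (G k n)
      else                   s k (G k n) ++ letter k 0 ∷ []

    G-suc : ∀ n → G k (suc n) ≡ nextGap n
    G-suc n with suc n <? k
    G-suc n       | no ≮k rewrite dec-false (suc n <? k) ≮k | suc-%≡1 n = refl
    -- The dummy value of `G 0` is the right one here: s̃ of the empty word is `p 0`.
    G-suc zero    | yes <k rewrite G-small 0 <k | z-small 0 <k | z-0 = refl
    G-suc (suc n) | yes <k rewrite G-small (suc n) <k | G-small n (<⇒≤ <k)
                                 | z-small (suc n) <k | z-small n (<⇒≤ <k) = sym (s-p n)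

    -- This merges the three forms of the rule. The mark `g n` supplies the letter by which s̃ lags
    -- behind `s`, and `h (suc n)` is the appended 0. Since 1 < k, `z n` and `z (suc n)` never hold
    -- together.
    g-G : ∀ n → g n ++ G k (suc n) ≡ s k (G k n) ++ h (suc n)
    g-G n rewrite G-suc n with z n in eq
    ... | true  rewrite z-suc n eq = 0-s̃ (G k n)
    ... | false with z (suc n)
    ...   | true  = sym (++-identityʳ _)
    ...   | false = refl

    -- Kernel numbers double up to the marks

    -- Equal to r (c + m) + ⋯ + r (m + 1).
    window : ℕ → ℕ → ℕ
    window c m = sum (take c (kernelNumbers k (c + m)))

    drop-kernelNumbers : ∀ c m → drop c (kernelNumbers k (c + m)) ≡ kernelNumbers k m
    drop-kernelNumbers zero    m = refl
    drop-kernelNumbers (suc c) m = drop-kernelNumbers c m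

    -- Both sides are r (m + 1) + ⋯ + r (m + c + 1), with the lowest and the highest term split off
    -- respectively.
    window-shift : ∀ c m → window c (suc m) + r k (suc m) ≡ r k (suc (c + m)) + window c m
    window-shift zero    m = sym (+-identityʳ _)
    window-shift (suc c) m = begin
      r k (suc (c + suc m)) + window c (suc m) + r k (suc m)
        ≡⟨ +-assoc (r k (suc (c + suc m))) _ _ ⟩
      r k (suc (c + suc m)) + (window c (suc m) + r k (suc m))
        ≡⟨ cong₂ (λ x y → r k (suc x) + y) (+-suc c m) (window-shift c m) ⟩
      r k (suc (suc (c + m))) + window (suc c) m  ∎

    r-small : ∀ i → i < k → r k (suc i) ≡ 1
    r-small i i<k rewrite dec-true (suc i ≤? k) i<k = refl

    window-0 : ∀ c → c ≤ k → window c 0 ≡ c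
    window-0 zero    _   = refl
    window-0 (suc c) c<k = cong₂ _+_
      (r-small (c + 0) (subst (_< k) (sym (+-identityʳ c)) c<k))
      (window-0 c (<⇒≤ c<k))

    1+[k∸1] : suc (k ∸ 1) ≡ k
    1+[k∸1] = m+[n∸m]≡n 0<k

    2+[k∸2] : 2 + (k ∸ 2) ≡ k
    2+[k∸2] = m+[n∸m]≡n 1<k

    1+[k∸2] : suc (k ∸ 2) ≡ k ∸ 1
    1+[k∸2] = suc-injective (trans 2+[k∸2] (sym 1+[k∸1]))

    -- The index k + m + 1 is written so that the `(k ∸ 1)`-st tail of the preceding list of kernel
    -- numbers visibly starts with r (m + 1).
    r-recurrence : ∀ m → r k (suc (k ∸ 1 + suc m)) ≡ window (k ∸ 1) (suc m) + 2 * r k (suc m) ∸ (k ∸ 2)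
    r-recurrence m
      rewrite dec-false (suc (k ∸ 1 + suc m) ≤? k)
                (<⇒≱ (subst (_< suc (k ∸ 1 + suc m)) 1+[k∸1] (s≤s (m<m+n (k ∸ 1) {suc m} (s≤s z≤n)))))
      | drop-kernelNumbers (k ∸ 1) (suc m) = refl

    -- This is the relation between lengths forced by s(R n) g n = h n R (n + 1).
    Doubling : ℕ → Set
    Doubling n = r k (suc n) + bit (not (z n)) ≡ 2 * r k n + bit (z n)

    doubling-small : ∀ i → i < k → Doubling i
    doubling-small zero    i<k rewrite r-small 0 i<k | z-0 = refl
    doubling-small (suc i) i<k rewrite r-small (suc i) i<k | r-small i (<⇒≤ i<k) | z-small i i<k = refl

    -- Inductively, r (n + 2) + 1 ≥ 2 r (n + 1) ≥ 2. Positivity keeps the recurrence from being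
    -- truncated and gives s(R n) a first letter to drop.
    doubling⇒positive : ∀ n → (∀ i → i ≤ n → Doubling i) → 1 ≤ r k (suc n)
    doubling⇒positive zero    _ = ≤-reflexive (sym (r-small 0 0<k))
    doubling⇒positive (suc n) d = +-cancelʳ-≤ 1 1 (r k (2 + n)) (≤R.begin
      2
        ≤R.≤⟨ *-monoʳ-≤ 2 (doubling⇒positive n λ i i≤n → d i (m≤n⇒m≤1+n i≤n)) ⟩
      2 * r k (suc n)                    ≤R.≤⟨ m≤m+n _ _ ⟩
      2 * r k (suc n) + bit (z (suc n))  ≤R.≡⟨ d (suc n) ≤-refl ⟨
      r k (2 + n) + bit (not (z (suc n)))
        ≤R.≤⟨ +-monoʳ-≤ (r k (2 + n)) (bit≤1 (not (z (suc n)))) ⟩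
      r k (2 + n) + 1                    ≤R.∎)
      where module ≤R = ≤-Reasoning

    -- The difference of two consecutive instances of the recurrence for r gives
    -- r (n + 1) - 2 r n = r (n + 1 - k) - 2 r (n - k), so Doubling propagates
    -- with period k.
    window-step : ∀ m →
      window (k ∸ 1) m + 2 * r k m ≡ r k (suc (k ∸ 1 + m)) + (k ∸ 2) → Doubling m →
      window (k ∸ 1) (suc m) + 2 * r k (suc m) + bit (not (z m)) ≡
        2 * r k (suc (k ∸ 1 + m)) + bit (z m) + (k ∸ 2)
    window-step m eq dbl = begin
      W′ + 2 * r₁ + bit (not (z m))       ≡⟨ arrange₁ W′ r₁ (bit (not (z m))) ⟩
      (W′ + r₁) + (r₁ + bit (not (z m)))  ≡⟨ cong₂ _+_ (window-shift (k ∸ 1) m) dbl ⟩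
      (q + W) + (2 * r k m + bit (z m))   ≡⟨ arrange₂ q W (r k m) (bit (z m)) ⟩
      q + (W + 2 * r k m) + bit (z m)     ≡⟨ cong (λ x → q + x + bit (z m)) eq ⟩
      q + (q + (k ∸ 2)) + bit (z m)       ≡⟨ arrange₃ q (k ∸ 2) (bit (z m)) ⟩
      2 * q + bit (z m) + (k ∸ 2)         ∎
      where
      W  = window (k ∸ 1) m
      W′ = window (k ∸ 1) (suc m)
      r₁ = r k (suc m)
      q  = r k (suc (k ∸ 1 + m))
      arrange₁ : ∀ a b c → a + 2 * b + c ≡ (a + b) + (b + c)
      arrange₁ = solve-∀
      arrange₂ : ∀ a b c d → (a + b) + (2 * c + d) ≡ a + (b + 2 * c) + d
      arrange₂ = solve-∀
      arrange₃ : ∀ a b c → a + (a + b) + c ≡ 2 * a + c + b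
      arrange₃ = solve-∀

    -- The recurrence, in additive form, is proved along with `Doubling`, since each needs earlier
    -- instances of the other. The additive form also holds for r k = 1, because r 0 = 0 and the
    -- other k - 1 terms are 1; the induction starts there.
    doubling-upTo : ∀ m →
      window (k ∸ 1) m + 2 * r k m ≡ r k (suc (k ∸ 1 + m)) + (k ∸ 2) × (∀ i → i ≤ k ∸ 1 + m → Doubling i)
    doubling-upTo zero = start , λ i i≤ →
      doubling-small i (subst (i <_) 1+[k∸1] (s≤s (subst (i ≤_) (+-identityʳ (k ∸ 1)) i≤)))
      where
      start : window (k ∸ 1) 0 + 0 ≡ r k (suc (k ∸ 1 + 0)) + (k ∸ 2)
      start = begin
        window (k ∸ 1) 0 + 0             ≡⟨ +-identityʳ _ ⟩
        window (k ∸ 1) 0                 ≡⟨ window-0 (k ∸ 1) (m∸n≤m k 1) ⟩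
        k ∸ 1                            ≡⟨ 1+[k∸2] ⟨
        1 + (k ∸ 2)                      ≡⟨ cong (_+ (k ∸ 2)) (r-small (k ∸ 1 + 0) lt) ⟨
        r k (suc (k ∸ 1 + 0)) + (k ∸ 2)  ∎
        where
        lt : k ∸ 1 + 0 < k
        lt = ≤-reflexive (trans (cong suc (+-identityʳ (k ∸ 1))) 1+[k∸1])
    doubling-upTo (suc m) with doubling-upTo m
    ... | eq , dbl = eq′ , dbl′
      where
      W = window (k ∸ 1) (suc m) + 2 * r k (suc m)
      q = r k (k ∸ 1 + suc m)

      -- The index on the right is m + k.
      z-eq : z m ≡ z (k ∸ 1 + suc m)
      z-eq = trans (sym (z-period m)) (cong z (begin
        m + k            ≡⟨ cong (m +_) 1+[k∸1] ⟨
        m + suc (k ∸ 1)  ≡⟨ +-suc m (k ∸ 1) ⟩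
        suc m + (k ∸ 1)  ≡⟨ +-comm (suc m) (k ∸ 1) ⟩
        k ∸ 1 + suc m    ∎))

      W-eq : W + bit (not (z (k ∸ 1 + suc m))) ≡ 2 * q + bit (z (k ∸ 1 + suc m)) + (k ∸ 2)
      W-eq = subst₂ (λ b l → W + bit (not b) ≡ 2 * r k l + bit b + (k ∸ 2)) z-eq (sym (+-suc (k ∸ 1) m))
        (window-step m eq (dbl m (m≤n+m m (k ∸ 1))))

      1≤q : 1 ≤ q
      1≤q = subst (λ l → 1 ≤ r k l) (sym (+-suc (k ∸ 1) m)) (doubling⇒positive (k ∸ 1 + m) dbl)

      -- The subtraction in the recurrence is not truncated, as W + 1 ≥ 2q + (k - 2) ≥ 1 + (k - 2).
      k∸2≤W : k ∸ 2 ≤ W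
      k∸2≤W = +-cancelʳ-≤ 1 (k ∸ 2) W (≤R.begin
        k ∸ 2 + 1                                  ≤R.≡⟨ +-comm (k ∸ 2) 1 ⟩
        1 + (k ∸ 2)
          ≤R.≤⟨ +-monoˡ-≤ (k ∸ 2) (≤-trans 1≤q (≤-trans (m≤m+n q _) (m≤m+n (2 * q) _))) ⟩
        2 * q + bit (z (k ∸ 1 + suc m)) + (k ∸ 2)  ≤R.≡⟨ W-eq ⟨
        W + bit (not (z (k ∸ 1 + suc m)))
          ≤R.≤⟨ +-monoʳ-≤ W (bit≤1 (not (z (k ∸ 1 + suc m)))) ⟩
        W + 1                                      ≤R.∎)
        where module ≤R = ≤-Reasoning

      eq′ : W ≡ r k (suc (k ∸ 1 + suc m)) + (k ∸ 2)
      eq′ = trans (sym (m∸n+n≡m k∸2≤W)) (cong (_+ (k ∸ 2)) (sym (r-recurrence m)))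

      dbl-last : Doubling (k ∸ 1 + suc m)
      dbl-last = +-cancelʳ-≡ (k ∸ 2) _ _ (begin
        r′ + b̄ + (k ∸ 2)                          ≡⟨ +-assoc r′ b̄ (k ∸ 2) ⟩
        r′ + (b̄ + (k ∸ 2))                        ≡⟨ cong (r′ +_) (+-comm b̄ (k ∸ 2)) ⟩
        r′ + ((k ∸ 2) + b̄)                        ≡⟨ +-assoc r′ (k ∸ 2) b̄ ⟨
        r′ + (k ∸ 2) + b̄                          ≡⟨ cong (_+ b̄) eq′ ⟨
        W + b̄                                     ≡⟨ W-eq ⟩
        2 * q + bit (z (k ∸ 1 + suc m)) + (k ∸ 2)  ∎)
        where
        r′ = r k (suc (k ∸ 1 + suc m))
        b̄  = bit (not (z (k ∸ 1 + suc m)))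

      dbl′ : ∀ i → i ≤ k ∸ 1 + suc m → Doubling i
      dbl′ i i≤ with m≤n⇒m<n∨m≡n i≤
      ... | inj₁ i<   = dbl i (≤-pred (subst (i <_) (+-suc (k ∸ 1) m) i<))
      ... | inj₂ refl = dbl-last

    doubling : ∀ n → Doubling n
    doubling n = proj₂ (doubling-upTo n) n (m≤n+m n (k ∸ 1))

    -- Lengths of the kernel words

    bit-not-z≤r : ∀ n → bit (not (z n)) ≤ r k n
    bit-not-z≤r zero    rewrite z-0 = z≤n
    bit-not-z≤r (suc n) = ≤-trans (bit≤1 (not (z (suc n)))) (doubling⇒positive n (λ i _ → doubling i))

    -- The length is a hypothesis because `length-R` is itself proved from this equation by
    -- induction. It ensures that `R n` is nonempty when the first 0 of its image is dropped.
    h-R′ : ∀ n → length (R k n) ≡ r k n → h n ++ R k (suc n) ≡ s k (R k n) ++ g n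
    h-R′ n len rewrite R-suc n with z n | bit-not-z≤r n
    ... | true  | _   = refl
    ... | false | 1≤r = trans
      (sym (s-nonempty (R k n) (≤-trans 1≤r (≤-reflexive (sym len)))))
      (sym (++-identityʳ _))

    length-R : ∀ n → length (R k n) ≡ r k n
    length-R zero    = refl
    length-R (suc n) = +-cancelˡ-≡ (bit (not (z n))) _ _ (begin
      bit (not (z n)) + length (R k (suc n))
        ≡⟨ cong (_+ length (R k (suc n))) (length-mark (not (z n))) ⟨
      length (h n) + length (R k (suc n))  ≡⟨ length-++ (h n) ⟨
      length (h n ++ R k (suc n))          ≡⟨ cong length (h-R′ n (length-R n)) ⟩
      length (s k (R k n) ++ g n)          ≡⟨ length-++ (s k (R k n)) ⟩
      length (s k (R k n)) + length (g n)  ≡⟨ cong₂ _+_ (length-s (R k n)) (length-mark (z n)) ⟩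
      2 * length (R k n) + bit (z n)
        ≡⟨ cong (λ l → 2 * l + bit (z n)) (length-R n) ⟩
      2 * r k n + bit (z n)                ≡⟨ doubling n ⟨
      r k (suc n) + bit (not (z n))        ≡⟨ +-comm (r k (suc n)) _ ⟩
      bit (not (z n)) + r k (suc n)        ∎)

    h-R : ∀ n → h n ++ R k (suc n) ≡ s k (R k n) ++ g n
    h-R n = h-R′ n (length-R n)

    -- Images of blocks and prefixes under `s`

    -- The mark `g n` is what the gap releases on its left and what the kernel word takes up on its
    -- right.
    s-F : ∀ n → s k (F n) ++ h (suc n) ≡ h n ++ F (suc n)
    s-F n = begin
      s k (R k n ++ G k n) ++ h′           ≡⟨ cong (_++ h′) (s-++ (R k n) (G k n)) ⟩
      (s k (R k n) ++ s k (G k n)) ++ h′   ≡⟨ ++-assoc (s k (R k n)) _ _ ⟩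
      s k (R k n) ++ s k (G k n) ++ h′     ≡⟨ cong (s k (R k n) ++_) (g-G n) ⟨
      s k (R k n) ++ g n ++ G k (suc n)    ≡⟨ ++-assoc (s k (R k n)) _ _ ⟨
      (s k (R k n) ++ g n) ++ G k (suc n)  ≡⟨ cong (_++ G k (suc n)) (h-R n) ⟨
      (h n ++ R k (suc n)) ++ G k (suc n)  ≡⟨ ++-assoc (h n) _ _ ⟩
      h n ++ F (suc n)                     ∎
      where h′ = h (suc n)

    s-blocks : ∀ a c → s k (blocks a c) ++ h (a + c) ≡ h a ++ blocks (suc a) c
    s-blocks a zero    = trans (cong h (+-identityʳ a)) (sym (++-identityʳ _))
    s-blocks a (suc c) = begin
      s k (F a ++ blocks (suc a) c) ++ h (a + suc c)
        ≡⟨ cong₂ (λ u n → u ++ h n) (s-++ (F a) _) (+-suc a c) ⟩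
      (s k (F a) ++ s k (blocks (suc a) c)) ++ h (suc a + c)
        ≡⟨ ++-assoc (s k (F a)) _ _ ⟩
      s k (F a) ++ s k (blocks (suc a) c) ++ h (suc a + c)
        ≡⟨ cong (s k (F a) ++_) (s-blocks (suc a) c) ⟩
      s k (F a) ++ h (suc a) ++ blocks (2 + a) c
        ≡⟨ ++-assoc (s k (F a)) _ _ ⟨
      (s k (F a) ++ h (suc a)) ++ blocks (2 + a) c
        ≡⟨ cong (_++ blocks (2 + a) c) (s-F a) ⟩
      (h a ++ F (suc a)) ++ blocks (2 + a) c
        ≡⟨ ++-assoc (h a) _ _ ⟩
      h a ++ blocks (suc a) (suc c)  ∎

    -- `V n` is mapped to a prefix of twice its length of s(R (n + 1)) g (n + 1) = h (n + 1) R (n +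
    -- 2), so only the lengths have to be compared.
    s-V : ∀ n → s k (V n) ≡ h (suc n) ++ V (suc n)
    s-V n = begin
      s k (take l (R k (suc n)))                     ≡⟨ s-take l (R k (suc n)) ⟩
      take (l * 2) (s k (R k (suc n)))
        ≡⟨ take-++-≤ (l * 2) (s k (R k (suc n))) (g (suc n)) l*2≤ ⟨
      take (l * 2) (s k (R k (suc n)) ++ g (suc n))  ≡⟨ cong₂ take l*2≡ (sym (h-R (suc n))) ⟩
      take (length h′ + l′) (h′ ++ R k (2 + n))      ≡⟨ take-length-+ h′ l′ (R k (2 + n)) ⟩
      h′ ++ V (suc n)                                ∎
      where
      l = r k n + bit (z n)
      l′ = r k (suc n) + bit (z (suc n))
      h′ = h (suc n)

      -- The prefix lies within `R (n + 1)`, so its image does not reach the mark `g (suc n)`.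
      l≤ : l ≤ r k (suc n)
      l≤ = +-cancelʳ-≤ (bit (not (z n))) l (r k (suc n)) (≤R.begin
        l + bit (not (z n))            ≤R.≤⟨ +-monoʳ-≤ l (bit-not-z≤r n) ⟩
        l + r k n                      ≤R.≡⟨ arrange (r k n) (bit (z n)) ⟩
        2 * r k n + bit (z n)          ≤R.≡⟨ doubling n ⟨
        r k (suc n) + bit (not (z n))  ≤R.∎)
        where
        module ≤R = ≤-Reasoning
        arrange : ∀ a b → a + b + a ≡ 2 * a + b
        arrange = solve-∀

      l*2≤ : l * 2 ≤ length (s k (R k (suc n)))
      l*2≤ = subst (l * 2 ≤_)
        (sym (trans (length-s (R k (suc n)))
          (trans (cong (2 *_) (length-R (suc n))) (*-comm 2 (r k (suc n))))))
        (*-monoˡ-≤ 2 l≤)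

      -- By doubling, 2l = r (n + 1) + 1; the 1 is then split into the two complementary bits at n +
      -- 1.
      l*2≡ : l * 2 ≡ length h′ + l′
      l*2≡ = begin
        (r k n + bit (z n)) * 2                    ≡⟨ arrange (r k n) (bit (z n)) ⟩
        2 * r k n + bit (z n) + bit (z n)          ≡⟨ cong (_+ bit (z n)) (doubling n) ⟨
        r k (suc n) + bit (not (z n)) + bit (z n)  ≡⟨ +-assoc (r k (suc n)) _ _ ⟩
        r k (suc n) + (bit (not (z n)) + bit (z n))
          ≡⟨ cong (r k (suc n) +_) (trans (bit-not (z n)) (sym (bit-not (z (suc n))))) ⟩
        r k (suc n) + (bit (not (z (suc n))) + bit (z (suc n)))
          ≡⟨ swap (r k (suc n)) (bit (not (z (suc n)))) (bit (z (suc n))) ⟩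
        bit (not (z (suc n))) + l′                 ≡⟨ cong (_+ l′) (length-mark (not (z (suc n)))) ⟨
        length h′ + l′                             ∎
        where
        arrange : ∀ a b → (a + b) * 2 ≡ 2 * a + b + b
        arrange = solve-∀
        swap : ∀ a b c → a + (b + c) ≡ b + (a + c)
        swap = solve-∀

    -- The gap equation

    -- The condition on `t` makes the mark emitted by `V t` the one that the blocks need on their
    -- right. The mark `h a` then emerges beside s(u). The word `u` is empty for small indices and
    -- `G m` later.
    gap-step : ∀ n a c t u w → suc t ≡ a + c →
      G k n ++ V n ≡ u ++ blocks a c ++ V t ++ w →
      g n ++ G k (suc n) ++ V (suc n) ≡
        (s k u ++ h a) ++ blocks (suc a) c ++ V (suc t) ++ s k w
    gap-step n a c t u w 1+t≡a+c eq = begin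
      g n ++ G k (suc n) ++ V (suc n)                           ≡⟨ ++-assoc (g n) _ _ ⟨
      (g n ++ G k (suc n)) ++ V (suc n)                         ≡⟨ cong (_++ V (suc n)) (g-G n) ⟩
      (s k (G k n) ++ h (suc n)) ++ V (suc n)                   ≡⟨ ++-assoc (s k (G k n)) _ _ ⟩
      s k (G k n) ++ h (suc n) ++ V (suc n)                     ≡⟨ cong (s k (G k n) ++_) (s-V n) ⟨
      s k (G k n) ++ s k (V n)                                  ≡⟨ s-++ (G k n) (V n) ⟨
      s k (G k n ++ V n)                                        ≡⟨ cong (s k) eq ⟩
      s k (u ++ blocks a c ++ V t ++ w)                         ≡⟨ s-++ u _ ⟩
      s k u ++ s k (blocks a c ++ V t ++ w)
        ≡⟨ cong (s k u ++_) (s-++ (blocks a c) _) ⟩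
      s k u ++ s k (blocks a c) ++ s k (V t ++ w)
        ≡⟨ cong (λ x → s k u ++ s k (blocks a c) ++ x)
             (trans (s-++ (V t) w) (cong (_++ s k w) (s-V t))) ⟩
      s k u ++ s k (blocks a c) ++ (h (suc t) ++ V (suc t)) ++ s k w
        ≡⟨ cong (λ x → s k u ++ s k (blocks a c) ++ x) (++-assoc (h (suc t)) _ _) ⟩
      s k u ++ s k (blocks a c) ++ h (suc t) ++ V (suc t) ++ s k w
        ≡⟨ cong (s k u ++_) (++-assoc (s k (blocks a c)) _ _) ⟨
      s k u ++ (s k (blocks a c) ++ h (suc t)) ++ V (suc t) ++ s k w
        ≡⟨ cong (λ n → s k u ++ (s k (blocks a c) ++ h n) ++ V (suc t) ++ s k w) 1+t≡a+c ⟩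
      s k u ++ (s k (blocks a c) ++ h (a + c)) ++ V (suc t) ++ s k w
        ≡⟨ cong (λ x → s k u ++ x ++ V (suc t) ++ s k w) (s-blocks a c) ⟩
      s k u ++ (h a ++ blocks (suc a) c) ++ V (suc t) ++ s k w
        ≡⟨ cong (s k u ++_) (++-assoc (h a) _ _) ⟩
      s k u ++ h a ++ blocks (suc a) c ++ V (suc t) ++ s k w
        ≡⟨ ++-assoc (s k u) _ _ ⟨
      (s k u ++ h a) ++ blocks (suc a) c ++ V (suc t) ++ s k w  ∎

    V-2 : 3 ≤ k → V 2 ≡ letter k 2 ∷ []
    V-2 3≤k rewrite r-small 1 1<k | z-small 1 3≤k | R-small 2 3≤k = refl

    gap-small : 3 ≤ k → ∀ n → 2 + n ≤ k → G k (2 + n) ++ V (2 + n) ≡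
      blocks 0 (suc n) ++ V n ++ s^ k n (letter k 2 ∷ [])
    gap-small 3≤k zero    _ =
      trans (cong₂ _++_ (G-small 1 3≤k) (V-2 3≤k)) (cong (_++ letter k 2 ∷ []) (sym V-0))
      where
      V-0 : V 0 ≡ letter k 0 ∷ []
      V-0 rewrite z-0 | R-small 0 0<k = refl
    -- Both outer marks are empty: `g (2 + n)` because 0 < 2 + n < k, and `h 0` because `z 0` holds.
    -- Also `F 0` is empty, so a block at index 0 can be prepended freely.
    gap-small 3≤k (suc n) 3+n≤k = subst₂
      (λ b c → mark b ++ G k (3 + n) ++ V (3 + n) ≡
        mark (not c) ++ blocks 1 (suc n) ++ V (suc n) ++ s^ k (suc n) (letter k 2 ∷ []))
      (z-small (suc n) 3+n≤k) z-0
      (gap-step (2 + n) 0 (suc n) n [] _ refl (gap-small 3≤k n (<⇒≤ 3+n≤k)))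

    gap : 3 ≤ k → ∀ m → G k (m + k) ++ V (m + k) ≡
      G k m ++ blocks (suc m) (k ∸ 2) ++ V (m + (k ∸ 2)) ++ s^ k (m + (k ∸ 2)) (letter k 2 ∷ [])
    -- `G 0` and `F 0` are empty, so this is the last case of `gap-small`.
    gap 3≤k zero    = subst
      (λ n → G k n ++ V n ≡ blocks 1 (k ∸ 2) ++ V (k ∸ 2) ++ s^ k (k ∸ 2) (letter k 2 ∷ []))
      2+[k∸2] (gap-small 3≤k (k ∸ 2) (≤-reflexive 2+[k∸2]))
    gap 3≤k (suc m) = ++-cancelˡ (g m) _ _ (begin
      g m ++ G k (suc (m + k)) ++ V (suc (m + k))
        ≡⟨ cong (λ b → mark b ++ G k (suc (m + k)) ++ V (suc (m + k))) (z-period m) ⟨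
      g (m + k) ++ G k (suc (m + k)) ++ V (suc (m + k))
        ≡⟨ gap-step (m + k) (suc m) (k ∸ 2) (m + (k ∸ 2)) (G k m) _ refl (gap 3≤k m) ⟩
      (s k (G k m) ++ h (suc m)) ++ rest  ≡⟨ cong (_++ rest) (g-G m) ⟨
      (g m ++ G k (suc m)) ++ rest        ≡⟨ ++-assoc (g m) _ _ ⟩
      g m ++ G k (suc m) ++ rest          ∎)
      where
      rest = blocks (2 + m) (k ∸ 2) ++ V (suc m + (k ∸ 2)) ++
        s^ k (suc m + (k ∸ 2)) (letter k 2 ∷ [])

    -- Removing the suffix `V`

    -- The word 2 is `V 2` itself, and by `s-V` a word ending in `V (2 + n)` has an image ending in
    -- `V (3 + n)`.
    V-suffix : 3 ≤ k → ∀ n → ∃[ u ] s^ k n (letter k 2 ∷ []) ≡ u ++ V (2 + n)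
    V-suffix 3≤k zero    = [] , sym (V-2 3≤k)
    V-suffix 3≤k (suc n) with V-suffix 3≤k n
    ... | u , eq = s k u ++ h (3 + n) , (begin
      s k (s^ k n (letter k 2 ∷ []))     ≡⟨ cong (s k) eq ⟩
      s k (u ++ V (2 + n))               ≡⟨ s-++ u _ ⟩
      s k u ++ s k (V (2 + n))           ≡⟨ cong (s k u ++_) (s-V (2 + n)) ⟩
      s k u ++ h (3 + n) ++ V (3 + n)    ≡⟨ ++-assoc (s k u) _ _ ⟨
      (s k u ++ h (3 + n)) ++ V (3 + n)  ∎)

    -- As `w` ends in `V (2 + t)`, it is the shortened word followed by that suffix, which can then
    -- be cancelled on the right of `gap`.
    gap-word : 3 ≤ k → ∀ m t → 2 + t ≡ m + k → let w = s^ k t (letter k 2 ∷ []) in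
      Suffix _≡_ (V (2 + t)) w × G k (2 + t) ≡ G k m ++ blocks (suc m) (k ∸ 2) ++ V t ++ w · V (2 + t) ⁻¹
    gap-word 3≤k m t 2+t≡m+k with V-suffix 3≤k t
    ... | u , w≡u++v = subst (Suffix _≡_ v) (sym w≡u++v) (u ++ˢ here (Pointwise.refl refl)) ,
      ++-cancelʳ v _ _ (begin
        G k (2 + t) ++ v
          ≡⟨ subst₂ (λ n t → G k n ++ V n ≡ G k m ++ bs ++ V t ++ s^ k t (letter k 2 ∷ []))
                                                  (sym 2+t≡m+k) (sym t≡m+[k∸2]) (gap 3≤k m) ⟩
        G k m ++ bs ++ V t ++ w                ≡⟨ cong (λ x → G k m ++ bs ++ V t ++ x) w≡w·v⁻¹++v ⟩
        G k m ++ bs ++ V t ++ w · v ⁻¹ ++ v    ≡⟨ ++-assoc₄ (G k m) bs (V t) (w · v ⁻¹) v ⟩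
        (G k m ++ bs ++ V t ++ w · v ⁻¹) ++ v  ∎)
      where
      v = V (2 + t)
      w = s^ k t (letter k 2 ∷ [])
      bs = blocks (suc m) (k ∸ 2)

      w≡w·v⁻¹++v : w ≡ w · v ⁻¹ ++ v
      w≡w·v⁻¹++v = subst (λ x → x ≡ x · v ⁻¹ ++ v) (sym w≡u++v) (cong (_++ v) (sym (++-·⁻¹ u v)))

      t≡m+[k∸2] : t ≡ m + (k ∸ 2)
      t≡m+[k∸2] = trans (cong (_∸ 2) 2+t≡m+k) (+-∸-assoc m 1<k)

      ++-assoc₄ : ∀ (a b c d e : Word k) → a ++ b ++ c ++ d ++ e ≡ (a ++ b ++ c ++ d) ++ e
      ++-assoc₄ a b c d e = sym (trans (++-assoc a _ e) (cong (a ++_)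
        (trans (++-assoc b _ e) (cong (b ++_) (++-assoc c d e)))))

-- Translation into the form of the statement

theorem6 : (k : ℕ) .{{_ : NonZero k}} → 3 ≤ k → (n : ℕ) → k + 1 ≤ n →
    let
      w = s^ k (n ∸ 2) (letter k 2 ∷ [])
      v = if n % k ≡ᵇ 0
          then R k (n + 1) ⟦ 1 ⋯ r k n + 1 ⟧
          else R k (n + 1) ⟦ 1 ⋯ r k n ⟧
      Π = ∏[ k ∸ 1 ↘ 2 ] (λ i → R k (n ∸ i) ++ G k (n ∸ i))
    in
    Suffix _≡_ v w
    × G k n ≡
      (if (n ∸ 1) % k ≡ᵇ 1
       then G k (n ∸ k) ++ Π ++ R k (n ∸ 1) ⟦ 1 ⋯ r k (n ∸ 2) + 1 ⟧ ++ w · v ⁻¹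
       else G k (n ∸ k) ++ Π ++ R k (n ∸ 1) ⟦ 1 ⋯ r k (n ∸ 2) ⟧ ++ w · v ⁻¹)
theorem6 k 3≤k 0 k+1≤n = contradiction (≤-trans (m≤n+m 1 k) k+1≤n) λ ()
theorem6 k 3≤k 1 k+1≤n = contradiction (≤-trans 3≤k (≤-trans (m≤m+n k 1) k+1≤n)) λ { (s≤s ()) }
theorem6 k 3≤k n@(suc (suc t)) k+1≤n =
  subst (λ v → Suffix _≡_ v w × G k n ≡ (if suc t % k ≡ᵇ 1 then formula v x₁ else formula v x₀))
    (sym v≡V)
    (proj₁ core , (begin
      G k n                                                                ≡⟨ proj₂ core ⟩
      G k m ++ blocks k (suc m) (k ∸ 2) ++ V k t ++ w · V k n ⁻¹
        ≡⟨ cong₂ (λ Π x → G k m ++ Π ++ x ++ w · V k n ⁻¹) Π≡blocks if≡V ⟨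
      formula (V k n) (if suc t % k ≡ᵇ 1 then x₁ else x₀)
        ≡⟨ if-float (formula (V k n)) (suc t % k ≡ᵇ 1) ⟩
      (if suc t % k ≡ᵇ 1 then formula (V k n) x₁ else formula (V k n) x₀)  ∎))
  where
  1<k : 1 < k
  1<k = ≤-trans (n≤1+n 2) 3≤k

  m  = n ∸ k
  w  = s^ k t (letter k 2 ∷ [])
  x₁ = R k (suc t) ⟦ 1 ⋯ r k t + 1 ⟧
  x₀ = R k (suc t) ⟦ 1 ⋯ r k t ⟧
  Π  = ∏[ k ∸ 1 ↘ 2 ] (λ i → R k (n ∸ i) ++ G k (n ∸ i))

  formula : Word k → Word k → Word k
  formula v x = G k m ++ Π ++ x ++ w · v ⁻¹

  n≡m+k : n ≡ m + k
  n≡m+k = sym (m∸n+n≡m (≤-trans (m≤m+n k 1) k+1≤n))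

  core : Suffix _≡_ (V k n) w × G k n ≡ G k m ++ blocks k (suc m) (k ∸ 2) ++ V k t ++ w · V k n ⁻¹
  core = gap-word k 1<k 3≤k m t n≡m+k

  v≡V : (if n % k ≡ᵇ 0 then R k (n + 1) ⟦ 1 ⋯ r k n + 1 ⟧ else R k (n + 1) ⟦ 1 ⋯ r k n ⟧) ≡ V k n
  v≡V = subst (λ l → (if n % k ≡ᵇ 0 then R k l ⟦ 1 ⋯ r k n + 1 ⟧ else R k l ⟦ 1 ⋯ r k n ⟧) ≡ V k n)
    (+-comm 1 n) (V-≡ k n)

  -- With t = n - 2, the condition n - 1 ≡ 1 says t ≡ 0 (mod k), which is the case distinction in
  -- `V t`.
  if≡V : (if suc t % k ≡ᵇ 1 then x₁ else x₀) ≡ V k t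
  if≡V = trans (cong (λ b → if b then x₁ else x₀) (suc-%≡1 k 1<k t)) (V-≡ k t)

  Π≡blocks : Π ≡ blocks k (suc m) (k ∸ 2)
  Π≡blocks = trans
    (cong (λ l → concatMap (λ i → F k (n ∸ i)) (map (2 +_) (downFrom l))) (∸-+-assoc k 1 1))
    (∏-descending k (k ∸ 2) (suc m) n (begin
      n                  ≡⟨ n≡m+k ⟩
      m + k              ≡⟨ cong (m +_) (2+[k∸2] k 1<k) ⟨
      m + (2 + (k ∸ 2))  ≡⟨ +-assoc m 2 (k ∸ 2) ⟨
      m + 2 + (k ∸ 2)    ≡⟨ cong (_+ (k ∸ 2)) (+-comm m 2) ⟩
      2 + m + (k ∸ 2)    ∎))
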